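{- Fix constants $\ell,k\ge1$ and $d\ge\ell k+1$. For every fixed-support canonical sketch family (with parameters $k,\ell$), for all sufficiently large $V$, the following zero-error guarantee fails: $$\forall A\subseteq\mathcal U^*\text{ with }|A|=d:\qquad \Pr_\omega\big[\mathsf{Dec}^\omega(\mathsf{Enc}^\omega(A))=A\big]=1 .$$
   Context: **Universe.** $\mathcal U=\mathbb F_p$ with $p$ prime, $V=p$, $\mathcal U^*=\mathcal U\setminus\{0\}$; $V$ ranges over primes; $o_V(1)$ means tending to $0$ as $V\to\infty$ for fixed $d$; $[n]=\{1,\dots,n\}$. **Fixed-support canonical sketch family** (fixed constants $k,\ell\ge1$). For every $d,V$, a family $\mathcal A$ samples public randomness $\omega$; after fixing $\omega$, encoding and decoding are deterministic. It maintains $M_d$ persistent cells ($M_d$ depends on $d$ only, not on $V$), which hold all persistent information; each cell has at most $V^{\ell+r_d(V)}$ possible states, where $r_d(V)=o_V(1)$ for each fixed $d$. For each $\omega$ there are an encoding map $\mathsf{Enc}^\omega_{d,V}$ from subsets of $\mathcal U^*$ to sketch states and, for each $x\in\mathcal U^*$, an update map $\mathsf{Upd}^\omega_{d,V,x}$ on sketch states such that: (1) *Fixed support*: each $x\in\mathcal U^*$ has a predetermined write support $S^\omega_{d,V}(x)\subseteq[M_d]$ with $|S^\omega_{d,V}(x)|\le k$; $\mathsf{Upd}^\omega_{d,V,x}$ may depend on the whole state but changes only cells in $S^\omega_{d,V}(x)$. (2) *Canonicality*: for all $A\subseteq\mathcal U^*$ and $x\in\mathcal U^*\setminus A$, $\mathsf{Enc}^\omega_{d,V}(A\cup\{x\})=\mathsf{Upd}^\omega_{d,V,x}(\mathsf{Enc}^\omega_{d,V}(A))$.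 The decoder $\mathsf{Dec}^\omega_{d,V}$ is an arbitrary function of a pair of sketch states; on $(\mathsf{Enc}(A),\mathsf{Enc}(B))$ it aims to output $(A\setminus B,B\setminus A)$. $\mathsf{Dec}^\omega(\mathsf{Enc}^\omega(A))$ abbreviates the first component of $\mathsf{Dec}^\omega_{d,V}(\mathsf{Enc}^\omega_{d,V}(A),\mathsf{Enc}^\omega_{d,V}(\varnothing))$. -}

module Defs where

open import Data.Fin.Base using (Fin; zero; suc; toℕ)
open import Data.Fin.Subset as Subset using (Subset; ⁅_⁆; _∪_; ∣_∣)
open import Data.Fin.Subset.Properties using (∉⊥; x∈p∪q⁻; x∈⁅y⁆⇒x≡y)
open import Data.Integer.Base as ℤ using (ℤ; -[1+_])
open import Data.Irrelevant using ([_])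
open import Data.Nat.Base as ℕ using (ℕ; zero; suc; NonZero)
open import Data.Nat.Primality using (Prime)
import Data.Nat.Properties as ℕ
open import Data.Product.Base using (∃-syntax; Σ-syntax; _×_; _,_; proj₁)
open import Data.Rational.Base as ℚ using (ℚ; 0ℚ; 1ℚ; ½; _/_)
import Data.Rational.Properties as ℚ
open import Data.Rational.Solver using (module +-*-Solver)
open import Data.Refinement.Base using (Refinement-syntax; _,_; value)
open import Data.Sum.Base using ([_,_]′)
open import Data.Vec.Base as Vec using (Vec)
open import Data.Vec.Relation.Unary.All using (All; _∷_)
open import Level using (0ℓ)
open import Relation.Binary.PropositionalEquality
  using (_≡_; _≢_; refl; sym; trans; cong; subst)
open import Relation.Nullary using (contradiction)
open import Relation.Unary using (Pred; U; ∅; ∁; _∩_; ⋃; _⊥_; _≐_)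

------------------------------------------------------------------------
-- Real numbers as Cauchy sequences of rationals

record ℝ : Set where
  constructor mkℝ
  field
    seq    : ℕ → ℚ
    cauchy : ∀ ε → 0ℚ ℚ.< ε → ∃[ N ] ∀ m n → N ℕ.≤ m → N ℕ.≤ n →
             ℚ.∣ seq m ℚ.- seq n ∣ ℚ.≤ ε

open ℝ public using (seq)

fromℚ : ℚ → ℝ
fromℚ q = mkℝ (λ _ → q) λ ε 0<ε → 0 , λ _ _ _ _ →
  subst (λ z → ℚ.∣ z ∣ ℚ.≤ ε) (sym (ℚ.+-inverseʳ q)) (ℚ.<⇒≤ 0<ε)

0ℝ 1ℝ : ℝ
0ℝ = fromℚ 0ℚ
1ℝ = fromℚ 1ℚ

infixl 6 _+ᴿ_
infix  4 _≤ᴿ_ _≈ᴿ_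

private
  halve : ∀ ε → ½ ℚ.* ε ℚ.+ ½ ℚ.* ε ≡ ε
  halve ε = trans (sym (ℚ.*-distribʳ-+ ε ½ ½)) (ℚ.*-identityˡ ε)

  interchange : ∀ a b c d → (a ℚ.+ b) ℚ.- (c ℚ.+ d) ≡ (a ℚ.- c) ℚ.+ (b ℚ.- d)
  interchange = solve 4 (λ a b c d → (a :+ b) :- (c :+ d) := (a :- c) :+ (b :- d)) refl
    where open +-*-Solver

_+ᴿ_ : ℝ → ℝ → ℝ
mkℝ x x-cauchy +ᴿ mkℝ y y-cauchy = mkℝ (λ n → x n ℚ.+ y n) λ ε 0<ε →
  let 0<½ε     = ℚ.*-monoʳ-<-pos ½ 0<ε
      M , x-close = x-cauchy (½ ℚ.* ε) 0<½ε
      N , y-close = y-cauchy (½ ℚ.* ε) 0<½ε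
  in M ℕ.⊔ N , λ m n ≤m ≤n → begin
    ℚ.∣ (x m ℚ.+ y m) ℚ.- (x n ℚ.+ y n) ∣
      ≡⟨ cong ℚ.∣_∣ (interchange (x m) (y m) (x n) (y n)) ⟩
    ℚ.∣ (x m ℚ.- x n) ℚ.+ (y m ℚ.- y n) ∣
      ≤⟨ ℚ.∣p+q∣≤∣p∣+∣q∣ (x m ℚ.- x n) (y m ℚ.- y n) ⟩
    ℚ.∣ x m ℚ.- x n ∣ ℚ.+ ℚ.∣ y m ℚ.- y n ∣
      ≤⟨ ℚ.+-mono-≤
           (x-close m n (ℕ.m⊔n≤o⇒m≤o M N ≤m) (ℕ.m⊔n≤o⇒m≤o M N ≤n))
           (y-close m n (ℕ.m⊔n≤o⇒n≤o M N ≤m) (ℕ.m⊔n≤o⇒n≤o M N ≤n)) ⟩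
    ½ ℚ.* ε ℚ.+ ½ ℚ.* ε
      ≡⟨ halve ε ⟩
    ε ∎
  where open ℚ.≤-Reasoning

_≤ᴿ_ : ℝ → ℝ → Set
x ≤ᴿ y = ∀ ε → 0ℚ ℚ.< ε → ∃[ N ] ∀ n → N ℕ.≤ n → seq x n ℚ.≤ seq y n ℚ.+ ε

_≈ᴿ_ : ℝ → ℝ → Set
x ≈ᴿ y = x ≤ᴿ y × y ≤ᴿ x

-- Limit of s n as n → ∞ through the indices satisfying P.
_⟶_along_ : (ℕ → ℝ) → ℝ → Pred ℕ 0ℓ → Set
s ⟶ l along P = ∀ ε → 0ℚ ℚ.< ε → ∃[ N ] ∀ n → P n → N ℕ.≤ n →
  s n ≤ᴿ l +ᴿ fromℚ ε × l ≤ᴿ s n +ᴿ fromℚ ε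

partialSum : (ℕ → ℝ) → ℕ → ℝ
partialSum s zero    = 0ℝ
partialSum s (suc n) = partialSum s n +ᴿ s n

-- N ≤ V ^ (a / b), cleared of roots and of negative exponents.
_≤_^[_/_] : ℕ → ℕ → ℤ → ℕ → Set
N ≤ V ^[ ℤ.+ a    / b ] = N ℕ.^ b ℕ.≤ V ℕ.^ a
N ≤ V ^[ -[1+ a ] / b ] = N ℕ.^ b ℕ.* V ℕ.^ suc a ℕ.≤ 1

-- N ≤ V ^ ρ for V ≥ 1, where V ^ ρ is the infimum of V ^ q over the
-- rationals q ≥ ρ.
_≤_^ᴿ_ : ℕ → ℕ → ℝ → Set
N ≤ V ^ᴿ ρ = ∀ (a : ℤ) (b : ℕ) .{{_ : NonZero b}} →
  ρ ≤ᴿ fromℚ (a / b) → N ≤ V ^[ a / b ]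

------------------------------------------------------------------------
-- Probability spaces

-- Classically the bounded monotone partial sums in σ-additive always
-- converge, so the measurable sets are exactly a σ-algebra and ℙ is a
-- countably additive probability.  Constructively, closure under unions
-- without a given limit would already need LPO for a one-point space.
-- ℙ-resp also says that ℙ does not depend on the measurability proof.
record ProbabilitySpace : Set₁ where
  field
    Ω          : Set
    Measurable : Pred (Pred Ω 0ℓ) 0ℓ
    ℙ          : ∀ {E} → Measurable E → ℝ

    U-measurable : Measurable U
    ∅-measurable : Measurable ∅
    ∁-measurable : ∀ {E} → Measurable E → Measurable (∁ E)
    ∩-measurable : ∀ {E F} → Measurable E → Measurable F → Measurable (E ∩ F)
    ≐-measurable : ∀ {E F} → E ≐ F → Measurable E → Measurable F

    ℙ-resp   : ∀ {E F} → E ≐ F → (e : Measurable E) (f : Measurable F) → ℙ e ≈ᴿ ℙ f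
    ℙ-nonneg : ∀ {E} (e : Measurable E) → 0ℝ ≤ᴿ ℙ e
    ℙ-∅      : ℙ ∅-measurable ≈ᴿ 0ℝ
    ℙ-U      : ℙ U-measurable ≈ᴿ 1ℝ

    σ-additive : (E : ℕ → Pred Ω 0ℓ) (e : ∀ n → Measurable (E n)) →
                 (∀ i j → i ≢ j → E i ⊥ E j) →
                 ∀ p → partialSum (λ n → ℙ (e n)) ⟶ p along U →
                 Σ[ u ∈ Measurable (⋃ ℕ E) ] ℙ u ≈ᴿ p

  Pr[_]≡1 : Pred Ω 0ℓ → Set
  Pr[ E ]≡1 = Σ[ e ∈ Measurable E ] ℙ e ≈ᴿ 1ℝ

------------------------------------------------------------------------
-- The universe

-- The residues modulo V; only the underlying set of 𝔽_V plays a role.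
𝒰 : ℕ → Set
𝒰 V = Fin V

𝒰* : ℕ → Set
𝒰* V = [ x ∈ 𝒰 V ∣ toℕ x ≢ 0 ]

Subset* : ℕ → Set
Subset* V = [ A ∈ Subset V ∣ (∀ {x} → x Subset.∈ A → toℕ x ≢ 0) ]

module _ {V : ℕ} where

  infix 4 _∉*_

  _∉*_ : 𝒰* V → Subset* V → Set
  x ∉* A = value x Subset.∉ value A

  ∅* : Subset* V
  ∅* = Subset.⊥ , [ (λ x∈⊥ → contradiction x∈⊥ ∉⊥) ]

  _∪⁅_⁆ : Subset* V → 𝒰* V → Subset* V
  (A , [ A⊆𝒰* ]) ∪⁅ x , [ x≢0 ] ⁆ = A ∪ ⁅ x ⁆ ,
    [ (λ y∈ → [ A⊆𝒰* , (λ y∈⁅x⁆ → subst (λ z → toℕ z ≢ 0) (sym (x∈⁅y⁆⇒x≡y x y∈⁅x⁆)) x≢0) ]′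
                (x∈p∪q⁻ A ⁅ x ⁆ y∈)) ]

  ∣_∣* : Subset* V → ℕ
  ∣ A ∣* = ∣ value A ∣

------------------------------------------------------------------------
-- Sketches

-- A state gives cell i one of size i possible values.
State : ∀ {M} → Vec ℕ M → Set
State size = All Fin size

cell : ∀ {M} {size : Vec ℕ M} → State size → (i : Fin M) → Fin (Vec.lookup size i)
cell (c ∷ _)  zero    = c
cell (_ ∷ cs) (suc i) = cell cs i

-- The deterministic data that remain once the randomness is fixed.
record Sketch (k V : ℕ) {M : ℕ} (size : Vec ℕ M) : Set where
  field
    Enc     : Subset* V → State size
    Upd     : 𝒰* V → State size → State size
    Dec     : State size → State size → Subset* V × Subset* V
    support : 𝒰* V → Subset M

    support-size  : ∀ x → ∣ support x ∣ ℕ.≤ k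
    fixed-support : ∀ x s i → i Subset.∉ support x → cell (Upd x s) i ≡ cell s i
    canonical     : ∀ A x → x ∉* A → Enc (A ∪⁅ x ⁆) ≡ Upd x (Enc A)

  decode : State size → Subset* V
  decode s = proj₁ (Dec s (Enc ∅*))

record SketchFamily (k ℓ : ℕ) : Set₁ where
  field
    M    : ℕ → ℕ
    r    : ℕ → ℕ → ℝ
    r→0  : ∀ d → r d ⟶ 0ℝ along Prime
    size : ∀ d V → Vec ℕ (M d)
    size-bound : ∀ d V → Prime V → ∀ i →
                 Vec.lookup (size d V) i ≤ V ^ᴿ (fromℚ (ℤ.+ ℓ / 1) +ᴿ r d V)
    randomness : ∀ d V → Prime V → ProbabilitySpace
    sketch     : ∀ d V (p : Prime V) → ProbabilitySpace.Ω (randomness d V p) →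
                 Sketch k V (size d V)

ZeroError : ∀ {k ℓ} → SketchFamily k ℓ → ∀ d V → Prime V → Set
ZeroError 𝒜 d V p = ∀ (A : Subset* V) → ∣ A ∣* ≡ d →
  Pr[ (λ ω → let open Sketch (sketch d V p ω) in decode (Enc A) ≡ A) ]≡1
  where
  open SketchFamily 𝒜
  open ProbabilitySpace (randomness d V p)

{-# OPTIONS --safe #-}

-- Zero error makes one ω decode every d-set, since there are finitely many.
-- For this ω, pigeonhole on the 2 ^ M supports gives a set X of about V / 2 ^ M
-- elements with common support S.  The sketches of the d-subsets of X are
-- distinct and differ only inside S, so at most V ^ (k (ℓ + r)) of them exist,
-- whereas X has at least a constant multiple of V ^ d many d-subsets.  As
-- d ≥ ℓ k + 1 and k r ≤ ½ for large V, this bounds V.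

module Submission where

open import Defs
open import Algebra.Properties.CommutativeSemigroup using (interchange)
open import Data.Bool.Base using (Bool; true; false)
import Data.Bool.Properties as Bool
open import Data.Fin.Base as Fin using (Fin; zero; suc; combine; inject≤; funToFin; finToFun)
import Data.Fin.Properties as Fin
open import Data.Fin.Subset using (Subset; inside; outside; _∈_; _∉_; ⁅_⁆; ∣_∣)
  renaming (_∪_ to _∪ˢ_)
open import Data.Fin.Subset.Properties
  using (∉⊥; ∣⊥∣≡0; x∈p∪q⁻; x∈p∪q⁺; x∈⁅x⁆; x∈⁅y⁆⇒x≡y; ∪-identityʳ)
open import Data.Integer.Base as ℤ using (+_)
import Data.Integer.Properties as ℤ
open import Data.Irrelevant using ([_])
open import Data.List.Base using (List; []; _∷_; length; lookup; filter; allFin)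
open import Data.List.Membership.Propositional using () renaming (_∈_ to _∈ˡ_)
open import Data.List.Membership.Propositional.Properties using (∈-filter⁻; ∈-lookup)
open import Data.List.Properties using (length-tabulate)
import Data.List.Relation.Unary.All as All
open import Data.List.Relation.Unary.Unique.Propositional using (Unique; []; _∷_)
open import Data.List.Relation.Unary.Unique.Propositional.Properties using (filter⁺; allFin⁺)
open import Data.Nat.Base as ℕ
  using (ℕ; zero; suc; NonZero; _+_; _*_; _^_; _≤_; z≤n; s≤s; s≤s⁻¹; _⊔_)
open import Data.Nat.DivMod using (_/_; _%_; m≡m%n+[m/n]*n; m%n<n; m/n*n≤m; m≥n⇒m/n>0)
open import Data.Nat.Primality using (Prime)
import Data.Nat.Properties as ℕ
open import Data.Nat.Solver using (module +-*-Solver)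
open import Data.Product.Base using (∃-syntax; Σ-syntax; _×_; _,_; proj₁; proj₂)
open import Data.Rational.Base as ℚ using (0ℚ; 1ℚ; ½; toℚᵘ)
import Data.Rational.Properties as ℚ
open import Data.Rational.Unnormalised.Base as ℚᵘ using (mkℚᵘ; *≡*)
import Data.Rational.Unnormalised.Properties as ℚᵘ
open import Data.Refinement.Base using (_,_; value)
import Data.Refinement.Properties as Refinement
open import Data.Sum.Base using (inj₁; inj₂; [_,_]′)
open import Data.Vec.Base as Vec using (Vec; []; _∷_; here; there)
import Data.Vec.Properties as Vec
open import Data.Vec.Relation.Unary.All using ([]; _∷_)
open import Function.Base using (_∘_; case_of_)
open import Function.Definitions using (Injective)
open import Level using (0ℓ)
open import Relation.Binary.Bundles using (Preorder)
open import Relation.Binary.PropositionalEquality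
  using (_≡_; _≢_; _≗_; refl; sym; trans; cong; cong₂; subst; module ≡-Reasoning)
import Relation.Binary.Reasoning.Preorder
open import Relation.Nullary using (¬_; yes; no; ¬?; contradiction)
open import Relation.Nullary.Decidable using (from-no; _→-dec_)
open import Relation.Unary
  using (Pred; U; ∅; ∁; _∩_; _∪_; ⋃; _⊥_; _≐_; _⊆_; Decidable)
open import Relation.Unary.Properties using (_∩?_; ∁?)

-- Order and addition on the Cauchy reals

private
  p≤p+ε : ∀ p {ε} → 0ℚ ℚ.< ε → p ℚ.≤ p ℚ.+ ε
  p≤p+ε p 0<ε = ℚ.≤-trans (ℚ.≤-reflexive (sym (ℚ.+-identityʳ p))) (ℚ.+-monoʳ-≤ p (ℚ.<⇒≤ 0<ε))

  halves : ∀ ε → ½ ℚ.* ε ℚ.+ ½ ℚ.* ε ≡ ε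
  halves ε = trans (sym (ℚ.*-distribʳ-+ ε ½ ½)) (ℚ.*-identityˡ ε)

≤ᴿ-refl : ∀ {x} → x ≤ᴿ x
≤ᴿ-refl {x} ε 0<ε = 0 , λ n _ → p≤p+ε (seq x n) 0<ε

≤ᴿ-trans : ∀ {x y z} → x ≤ᴿ y → y ≤ᴿ z → x ≤ᴿ z
≤ᴿ-trans {x} {y} {z} x≤y y≤z ε 0<ε =
  let 0<½ε  = ℚ.*-monoʳ-<-pos ½ 0<ε
      M , p = x≤y (½ ℚ.* ε) 0<½ε
      N , q = y≤z (½ ℚ.* ε) 0<½ε
  in M ℕ.⊔ N , λ n ≤n → begin
    seq x n                                 ≤⟨ p n (ℕ.m⊔n≤o⇒m≤o M N ≤n) ⟩
    seq y n ℚ.+ ½ ℚ.* ε                     ≤⟨ ℚ.+-monoˡ-≤ (½ ℚ.* ε) (q n (ℕ.m⊔n≤o⇒n≤o M N ≤n)) ⟩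
    seq z n ℚ.+ ½ ℚ.* ε ℚ.+ ½ ℚ.* ε         ≡⟨ ℚ.+-assoc (seq z n) (½ ℚ.* ε) (½ ℚ.* ε) ⟩
    seq z n ℚ.+ (½ ℚ.* ε ℚ.+ ½ ℚ.* ε)       ≡⟨ cong (seq z n ℚ.+_) (halves ε) ⟩
    seq z n ℚ.+ ε                           ∎
  where open ℚ.≤-Reasoning

≗⇒≤ᴿ : ∀ {x y} → (∀ n → seq x n ≡ seq y n) → x ≤ᴿ y
≗⇒≤ᴿ {x} {y} x≗y ε 0<ε =
  0 , λ n _ → ℚ.≤-trans (ℚ.≤-reflexive (x≗y n)) (proj₂ (≤ᴿ-refl {y} ε 0<ε) n ℕ.z≤n)

≗⇒≈ᴿ : ∀ {x y} → (∀ n → seq x n ≡ seq y n) → x ≈ᴿ y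
≗⇒≈ᴿ {x} {y} x≗y = ≗⇒≤ᴿ {x} {y} x≗y , ≗⇒≤ᴿ {y} {x} (sym ∘ x≗y)

≤ᴿ-preorder : Preorder 0ℓ 0ℓ 0ℓ
≤ᴿ-preorder = record
  { Carrier    = ℝ
  ; _≈_        = _≈ᴿ_
  ; _≲_        = _≤ᴿ_
  ; isPreorder = record
    { isEquivalence = record
      { refl  = λ {x} → ≤ᴿ-refl {x} , ≤ᴿ-refl {x}
      ; sym   = λ (x≤y , y≤x) → y≤x , x≤y
      ; trans = λ {x} {y} {z} (x≤y , y≤x) (y≤z , z≤y) →
          ≤ᴿ-trans {x} {y} {z} x≤y y≤z , ≤ᴿ-trans {z} {y} {x} z≤y y≤x
      }
    ; reflexive = proj₁
    ; trans     = λ {x} {y} {z} → ≤ᴿ-trans {x} {y} {z}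
    }
  }

module ≤ᴿ-Reasoning = Relation.Binary.Reasoning.Preorder ≤ᴿ-preorder

+ᴿ-identityʳ : ∀ x → x +ᴿ 0ℝ ≈ᴿ x
+ᴿ-identityʳ x = ≗⇒≈ᴿ {x +ᴿ 0ℝ} {x} (ℚ.+-identityʳ ∘ seq x)

+ᴿ-identityˡ : ∀ x → 0ℝ +ᴿ x ≈ᴿ x
+ᴿ-identityˡ x = ≗⇒≈ᴿ {0ℝ +ᴿ x} {x} (ℚ.+-identityˡ ∘ seq x)

+ᴿ-comm : ∀ x y → x +ᴿ y ≈ᴿ y +ᴿ x
+ᴿ-comm x y = ≗⇒≈ᴿ {x +ᴿ y} {y +ᴿ x} λ n → ℚ.+-comm (seq x n) (seq y n)

+ᴿ-monoʳ-≤ : ∀ x {y z} → y ≤ᴿ z → x +ᴿ y ≤ᴿ x +ᴿ z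
+ᴿ-monoʳ-≤ x {y} {z} y≤z ε 0<ε = let N , p = y≤z ε 0<ε in N , λ n N≤n → begin
    seq x n ℚ.+ seq y n           ≤⟨ ℚ.+-monoʳ-≤ (seq x n) (p n N≤n) ⟩
    seq x n ℚ.+ (seq z n ℚ.+ ε)   ≡⟨ ℚ.+-assoc (seq x n) (seq z n) ε ⟨
    seq x n ℚ.+ seq z n ℚ.+ ε     ∎
  where open ℚ.≤-Reasoning

+ᴿ-monoˡ-≤ : ∀ x {y z} → y ≤ᴿ z → y +ᴿ x ≤ᴿ z +ᴿ x
+ᴿ-monoˡ-≤ x {y} {z} y≤z = begin
    y +ᴿ x   ≈⟨ +ᴿ-comm y x ⟩
    x +ᴿ y   ≲⟨ +ᴿ-monoʳ-≤ x {y} {z} y≤z ⟩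
    x +ᴿ z   ≈⟨ +ᴿ-comm x z ⟩
    z +ᴿ x   ∎
  where open ≤ᴿ-Reasoning

+ᴿ-congʳ : ∀ x {y z} → y ≈ᴿ z → x +ᴿ y ≈ᴿ x +ᴿ z
+ᴿ-congʳ x {y} {z} (y≤z , z≤y) = +ᴿ-monoʳ-≤ x {y} {z} y≤z , +ᴿ-monoʳ-≤ x {z} {y} z≤y

+ᴿ-congˡ : ∀ x {y z} → y ≈ᴿ z → y +ᴿ x ≈ᴿ z +ᴿ x
+ᴿ-congˡ x {y} {z} (y≤z , z≤y) = +ᴿ-monoˡ-≤ x {y} {z} y≤z , +ᴿ-monoˡ-≤ x {z} {y} z≤y

+ᴿ-cancelˡ-≤ : ∀ x {y z} → x +ᴿ y ≤ᴿ x +ᴿ z → y ≤ᴿ z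
+ᴿ-cancelˡ-≤ x {y} {z} x+y≤x+z ε 0<ε = let N , p = x+y≤x+z ε 0<ε in N , λ n N≤n → begin
    seq y n                                          ≡⟨ cancel (seq x n) (seq y n) ⟨
    ℚ.- seq x n ℚ.+ (seq x n ℚ.+ seq y n)            ≤⟨ ℚ.+-monoʳ-≤ (ℚ.- seq x n) (p n N≤n) ⟩
    ℚ.- seq x n ℚ.+ (seq x n ℚ.+ seq z n ℚ.+ ε)      ≡⟨ cong (ℚ.- seq x n ℚ.+_) (ℚ.+-assoc (seq x n) (seq z n) ε) ⟩
    ℚ.- seq x n ℚ.+ (seq x n ℚ.+ (seq z n ℚ.+ ε))    ≡⟨ cancel (seq x n) (seq z n ℚ.+ ε) ⟩
    seq z n ℚ.+ ε                                    ∎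
  where
  open ℚ.≤-Reasoning
  cancel : ∀ p q → ℚ.- p ℚ.+ (p ℚ.+ q) ≡ q
  cancel p q = trans (sym (ℚ.+-assoc (ℚ.- p) p q))
    (trans (cong (ℚ._+ q) (ℚ.+-inverseˡ p)) (ℚ.+-identityˡ q))

≤ᴿ-+ᴿ-fromℚ : ∀ x {ε} → 0ℚ ℚ.< ε → x ≤ᴿ x +ᴿ fromℚ ε
≤ᴿ-+ᴿ-fromℚ x {ε} 0<ε δ 0<δ = 0 , λ n _ → begin
    seq x n                 ≤⟨ p≤p+ε (seq x n) 0<ε ⟩
    seq x n ℚ.+ ε           ≤⟨ p≤p+ε (seq x n ℚ.+ ε) 0<δ ⟩
    seq x n ℚ.+ ε ℚ.+ δ     ∎
  where open ℚ.≤-Reasoning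

1≰ᴿ0 : ¬ 1ℝ ≤ᴿ 0ℝ
1≰ᴿ0 1≤0 = let N , p = 1≤0 ½ (ℚ.positive⁻¹ ½) in
  from-no (1ℚ ℚ.≤? 0ℚ ℚ.+ ½) (p N ℕ.≤-refl)

-- `ℚ./` normalises its result, so the computation runs in the unnormalised rationals, where it is a
-- cross multiplication.
integer+unit-fraction : ∀ ℓ b .{{_ : NonZero b}} →
                        + ℓ ℚ./ 1 ℚ.+ + 1 ℚ./ b ≡ + (ℓ * b + 1) ℚ./ b
integer+unit-fraction ℓ b@(suc b-1) = ℚ.toℚᵘ-injective (begin-equality
    toℚᵘ (+ ℓ ℚ./ 1 ℚ.+ + 1 ℚ./ b)           ≃⟨ ℚ.toℚᵘ-homo-+ (+ ℓ ℚ./ 1) (+ 1 ℚ./ b) ⟩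
    toℚᵘ (+ ℓ ℚ./ 1) ℚᵘ.+ toℚᵘ (+ 1 ℚ./ b)   ≃⟨ ℚᵘ.+-cong (ℚ.toℚᵘ-fromℚᵘ (mkℚᵘ (+ ℓ) 0)) (ℚ.toℚᵘ-fromℚᵘ (mkℚᵘ (+ 1) b-1)) ⟩
    mkℚᵘ (+ ℓ) 0 ℚᵘ.+ mkℚᵘ (+ 1) b-1         ≃⟨ *≡* (cong₂ ℤ._*_ numerator (cong +_ (sym (ℕ.*-identityˡ b)))) ⟩
    mkℚᵘ (+ (ℓ * b + 1)) b-1                 ≃⟨ ℚ.toℚᵘ-fromℚᵘ (mkℚᵘ (+ (ℓ * b + 1)) b-1) ⟨
    toℚᵘ (+ (ℓ * b + 1) ℚ./ b)               ∎)
  where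
  open ℚᵘ.≤-Reasoning
  numerator : + ℓ ℤ.* + b ℤ.+ + 1 ≡ + (ℓ * b + 1)
  numerator = cong (ℤ._+ + 1) (sym (ℤ.pos-* ℓ b))

-- Supplies the rational upper bound on the exponent that `_≤_^ᴿ_` asks for. The hypothesis has the
-- form that `r→0` delivers for the tolerance `1 / b`.
exponent-bound : ∀ ℓ b .{{_ : NonZero b}} ρ → ρ ≤ᴿ 0ℝ +ᴿ fromℚ (+ 1 ℚ./ b) →
                 fromℚ (+ ℓ ℚ./ 1) +ᴿ ρ ≤ᴿ fromℚ (+ (ℓ * b + 1) ℚ./ b)
exponent-bound ℓ b ρ ρ≤ = begin
    fromℚ q +ᴿ ρ                          ≲⟨ +ᴿ-monoʳ-≤ (fromℚ q) {ρ} {0ℝ +ᴿ ε} ρ≤ ⟩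
    fromℚ q +ᴿ (0ℝ +ᴿ ε)                  ≈⟨ +ᴿ-congʳ (fromℚ q) {0ℝ +ᴿ ε} {ε} (+ᴿ-identityˡ ε) ⟩
    fromℚ q +ᴿ ε                          ≈⟨ ≗⇒≈ᴿ {fromℚ q +ᴿ ε} {fromℚ _} (λ _ → integer+unit-fraction ℓ b) ⟩
    fromℚ (+ (ℓ * b + 1) ℚ./ b)           ∎
  where
  open ≤ᴿ-Reasoning
  q = + ℓ ℚ./ 1
  ε = fromℚ (+ 1 ℚ./ b)

-- Null sets

module _ (space : ProbabilitySpace) where
  open ProbabilitySpace space

  -- Countable additivity for the sequence `E`, `F`, `∅`, `∅`, ...: its partial sums stay the same
  -- from index 2 on, which supplies the explicit limit that `σ-additive` demands.
  ℙ-∪ : ∀ {E F} (e : Measurable E) (f : Measurable F) → E ⊥ F →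
        Σ[ u ∈ Measurable (E ∪ F) ] ℙ u ≈ᴿ ℙ e +ᴿ ℙ f
  ℙ-∪ {E} {F} e f E⊥F =
    let u , ℙu≈ = σ-additive G g disjoint (ℙ e +ᴿ ℙ f) converges
        u′      = ≐-measurable ⋃G≐E∪F u
    in u′ , (begin-equality
      ℙ u′           ≈⟨ ℙ-resp ⋃G≐E∪F u u′ ⟨
      ℙ u            ≈⟨ ℙu≈ ⟩
      ℙ e +ᴿ ℙ f     ∎)
    where
    open ≤ᴿ-Reasoning

    G : ℕ → Pred Ω 0ℓ
    G 0             = E
    G 1             = F
    G (suc (suc _)) = ∅

    g : ∀ n → Measurable (G n)
    g 0             = e
    g 1             = f
    g (suc (suc _)) = ∅-measurable

    disjoint : ∀ i j → i ≢ j → G i ⊥ G j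
    disjoint 0 0 i≢j = contradiction refl i≢j
    disjoint 0 1 _   = E⊥F
    disjoint 1 0 _ (a , b) = E⊥F (b , a)
    disjoint 1 1 i≢j = contradiction refl i≢j
    disjoint (suc (suc _)) _ _ = proj₁
    disjoint _ (suc (suc _)) _ = proj₂

    ⋃G≐E∪F : ⋃ ℕ G ≐ E ∪ F
    ⋃G≐E∪F = (λ where (0 , x∈E) → inj₁ x∈E
                      (1 , x∈F) → inj₂ x∈F) ,
             [ (0 ,_) , (1 ,_) ]′

    sum≈ : ∀ n → partialSum (λ n → ℙ (g n)) (2 ℕ.+ n) ≈ᴿ ℙ e +ᴿ ℙ f
    sum≈ zero    = +ᴿ-congˡ (ℙ f) {0ℝ +ᴿ ℙ e} {ℙ e} (+ᴿ-identityˡ (ℙ e))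
    sum≈ (suc n) = begin-equality
      s +ᴿ ℙ ∅-measurable   ≈⟨ +ᴿ-congʳ s {ℙ ∅-measurable} {0ℝ} ℙ-∅ ⟩
      s +ᴿ 0ℝ               ≈⟨ +ᴿ-identityʳ s ⟩
      s                     ≈⟨ sum≈ n ⟩
      ℙ e +ᴿ ℙ f            ∎
      where s = partialSum (λ n → ℙ (g n)) (2 ℕ.+ n)

    converges : partialSum (λ n → ℙ (g n)) ⟶ ℙ e +ᴿ ℙ f along U
    converges ε 0<ε = 2 , λ where
      (suc (suc n)) _ (ℕ.s≤s (ℕ.s≤s _)) →
        let s = partialSum (λ n → ℙ (g n)) (2 ℕ.+ n)
            l = ℙ e +ᴿ ℙ f
        in (begin
             s                 ≈⟨ sum≈ n ⟩
             l                 ≲⟨ ≤ᴿ-+ᴿ-fromℚ l 0<ε ⟩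
             l +ᴿ fromℚ ε      ∎) ,
           (begin
             l                 ≈⟨ sum≈ n ⟨
             s                 ≲⟨ ≤ᴿ-+ᴿ-fromℚ s 0<ε ⟩
             s +ᴿ fromℚ ε      ∎)

  -- One inequality is enough, as `ℙ-nonneg` gives the other.
  Null : Pred Ω 0ℓ → Set
  Null E = Σ[ e ∈ Measurable E ] ℙ e ≤ᴿ 0ℝ

  -- Additivity splits F along E, which needs a decision of membership in E.
  null-⊆ : ∀ {E F} → Decidable E → Measurable E → E ⊆ F → Null F → Null E
  null-⊆ {E} {F} E? e E⊆F (f , ℙf≤0) =
    let f∖e     = ∩-measurable f (∁-measurable e)
        u , ℙu≈ = ℙ-∪ e f∖e (λ (x∈E , _ , x∉E) → x∉E x∈E)
    in e , (begin
      ℙ e               ≈⟨ +ᴿ-identityʳ (ℙ e) ⟨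
      ℙ e +ᴿ 0ℝ         ≲⟨ +ᴿ-monoʳ-≤ (ℙ e) {0ℝ} {ℙ f∖e} (ℙ-nonneg f∖e) ⟩
      ℙ e +ᴿ ℙ f∖e      ≈⟨ ℙu≈ ⟨
      ℙ u               ≈⟨ ℙ-resp F≐ f u ⟨
      ℙ f               ≲⟨ ℙf≤0 ⟩
      0ℝ                ∎)
    where
    open ≤ᴿ-Reasoning
    F≐ : F ≐ E ∪ (F ∩ ∁ E)
    F≐ = (λ {x} x∈F → case E? x of λ where
           (yes x∈E) → inj₁ x∈E
           (no  x∉E) → inj₂ (x∈F , x∉E)) ,
         [ E⊆F , proj₁ ]′

  -- Replacing `F` by `F ∩ ∁ E` makes the union disjoint, and the smaller set is still null by
  -- `null-⊆`.
  null-∪ : ∀ {E F} → Decidable E → Decidable F → Null E → Null F → Null (E ∪ F)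
  null-∪ {E} {F} E? F? (e , ℙe≤0) (f , ℙf≤0) =
    let f∖e , ℙ≤0 = null-⊆ (F? ∩? ∁? E?) (∩-measurable f (∁-measurable e)) proj₁ (f , ℙf≤0)
        u , ℙu≈   = ℙ-∪ e f∖e (λ (x∈E , _ , x∉E) → x∉E x∈E)
        u′        = ≐-measurable ∪≐ u
    in u′ , (begin
      ℙ u′              ≈⟨ ℙ-resp ∪≐ u u′ ⟨
      ℙ u               ≈⟨ ℙu≈ ⟩
      ℙ e +ᴿ ℙ f∖e      ≲⟨ +ᴿ-monoʳ-≤ (ℙ e) {ℙ f∖e} {0ℝ} ℙ≤0 ⟩
      ℙ e +ᴿ 0ℝ         ≈⟨ +ᴿ-identityʳ (ℙ e) ⟩
      ℙ e               ≲⟨ ℙe≤0 ⟩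
      0ℝ                ∎)
    where
    open ≤ᴿ-Reasoning
    ∪≐ : E ∪ (F ∩ ∁ E) ≐ E ∪ F
    ∪≐ = [ inj₁ , inj₂ ∘ proj₁ ]′ ,
         λ {x} → [ inj₁ , (λ x∈F → case E? x of λ where
           (yes x∈E) → inj₁ x∈E
           (no  x∉E) → inj₂ (x∈F , x∉E)) ]′

  null-⋃ : ∀ {n} {E : Fin n → Pred Ω 0ℓ} → (∀ i → Decidable (E i)) →
           (∀ i → Null (E i)) → Null (⋃ (Fin n) E)
  null-⋃ {zero} _ _ = u , proj₁ (begin-equality
      ℙ u               ≈⟨ ℙ-resp ∅≐ ∅-measurable u ⟨
      ℙ ∅-measurable    ≈⟨ ℙ-∅ ⟩
      0ℝ                ∎)
    where
    open ≤ᴿ-Reasoning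
    ∅≐ : ∅ ≐ ⋃ (Fin 0) _
    ∅≐ = (λ ()) , λ ()
    u = ≐-measurable ∅≐ ∅-measurable
  null-⋃ {suc n} {E} E? E-null =
    -- A union of finitely many decidable sets is decidable by search, so `null-∪` applies to the
    -- union of the tail.
    let u , ℙu≤0 = null-∪ (E? zero) (λ x → Fin.any? λ i → E? (suc i) x)
                     (E-null zero) (null-⋃ (E? ∘ suc) (E-null ∘ suc))
        u′       = ≐-measurable ∪≐⋃ u
    in u′ , (begin
      ℙ u′              ≈⟨ ℙ-resp ∪≐⋃ u u′ ⟨
      ℙ u               ≲⟨ ℙu≤0 ⟩
      0ℝ                ∎)
    where
    open ≤ᴿ-Reasoning
    ∪≐⋃ : E zero ∪ ⋃ (Fin n) (E ∘ suc) ≐ ⋃ (Fin (suc n)) E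
    ∪≐⋃ = [ (zero ,_) , (λ (i , x∈Eᵢ) → suc i , x∈Eᵢ) ]′ ,
          λ where (zero  , x∈E₀) → inj₁ x∈E₀
                  (suc i , x∈Eᵢ) → inj₂ (i , x∈Eᵢ)

  -- Additivity makes the probabilities of `E` and `∁ E` add up to 1, which is already that of `E`;
  -- cancel the latter.
  Pr≡1⇒null-∁ : ∀ {E} → Decidable E → Pr[ E ]≡1 → Null (∁ E)
  Pr≡1⇒null-∁ {E} E? (e , ℙe≈1) =
    let ∁e      = ∁-measurable e
        u , ℙu≈ = ℙ-∪ e ∁e (λ (x∈E , x∉E) → x∉E x∈E)
    in ∁e , +ᴿ-cancelˡ-≤ (ℙ e) {ℙ ∁e} {0ℝ} (begin
      ℙ e +ᴿ ℙ ∁e       ≈⟨ ℙu≈ ⟨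
      ℙ u               ≈⟨ ℙ-resp ∪≐U u U-measurable ⟩
      ℙ U-measurable    ≈⟨ ℙ-U ⟩
      1ℝ                ≈⟨ ℙe≈1 ⟨
      ℙ e               ≈⟨ +ᴿ-identityʳ (ℙ e) ⟨
      ℙ e +ᴿ 0ℝ         ∎)
    where
    open ≤ᴿ-Reasoning
    ∪≐U : E ∪ ∁ E ≐ U
    ∪≐U = _ , λ {x} _ → case E? x of λ where
      (yes x∈E) → inj₁ x∈E
      (no  x∉E) → inj₂ x∉E

  -- If no `ω` lay in every `E i`, the complements would be finitely many null sets covering `Ω`,
  -- whence 1 ≤ 0. No `ω` is exhibited; the doubly negated form suffices to refute zero error.
  Pr≡1⇒consistent : ∀ {n} {E : Fin n → Pred Ω 0ℓ} → (∀ i → Decidable (E i)) →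
                    (∀ i → Pr[ E i ]≡1) → ¬ (∀ ω → ¬ (∀ i → E i ω))
  Pr≡1⇒consistent {n} {E} E? E-sure inconsistent =
    let u , ℙu≤0 = null-⋃ (∁? ∘ E?) λ i → Pr≡1⇒null-∁ (E? i) (E-sure i)
    in 1≰ᴿ0 (begin
      1ℝ                ≈⟨ ℙ-U ⟨
      ℙ U-measurable    ≈⟨ ℙ-resp U≐ U-measurable u ⟩
      ℙ u               ≲⟨ ℙu≤0 ⟩
      0ℝ                ∎)
    where
    open ≤ᴿ-Reasoning
    U≐ : U ≐ ⋃ (Fin n) (∁ ∘ E)
    -- Decidability over `Fin n` turns the failure of the conjunction into a definite index that
    -- fails.
    U≐ = (λ {ω} _ → Fin.¬∀⟶∃¬ n (λ i → E i ω) (λ i → E? i ω) (inconsistent ω)) , _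

-- Counting sketches with a common support

module _ {a} {A : Set a} where

  lookup-injective : ∀ {xs : List A} → Unique xs → Injective _≡_ _≡_ (lookup xs)
  lookup-injective (_ ∷ _)     {zero}  {zero}  _  = refl
  lookup-injective (x∉xs ∷ _)  {zero}  {suc j} eq = contradiction eq (All.lookup x∉xs (∈-lookup j))
  lookup-injective (x∉xs ∷ _)  {suc i} {zero}  eq = contradiction (sym eq) (All.lookup x∉xs (∈-lookup i))
  lookup-injective (_ ∷ xs!)   {suc i} {suc j} eq = cong suc (lookup-injective xs! eq)

  length-filter-¬ : ∀ {p} {P : Pred A p} (P? : Decidable P) xs →
                    length (filter P? xs) + length (filter (¬? ∘ P?) xs) ≡ length xs
  length-filter-¬ P? []       = refl
  length-filter-¬ P? (x ∷ xs) with P? x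
  ... | yes _ = cong suc (length-filter-¬ P? xs)
  ... | no  _ = trans (ℕ.+-suc _ _) (cong suc (length-filter-¬ P? xs))

  -- If `trues` has fewer than `m` entries, at least `m` of the `2 * m` or more entries are left to
  -- `falses`.
  majority : ∀ m (side : A → Bool) xs → Unique xs → 2 * m ≤ length xs →
             ∃[ b ] ∃[ ys ] m ≤ length ys × Unique ys ×
             (∀ {y} → y ∈ˡ ys → y ∈ˡ xs × side y ≡ b)
  majority m side xs xs! 2m≤ = case m ℕ.≤? length trues of λ where
      (yes m≤) → true , trues , m≤ , filter⁺ true? xs! , ∈-filter⁻ true?
      (no  m≰) → false , falses , m≤falses (ℕ.<⇒≤ (ℕ.≰⇒> m≰)) , filter⁺ (¬? ∘ true?) xs! ,
        λ y∈ → let y∈xs , y≢true = ∈-filter⁻ (¬? ∘ true?) y∈ in y∈xs , Bool.¬-not y≢true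
    where
    open ℕ.≤-Reasoning
    true? : Decidable (λ y → side y ≡ true)
    true? y = side y Bool.≟ true

    trues falses : List A
    trues  = filter true? xs
    falses = filter (¬? ∘ true?) xs

    m≤falses : length trues ≤ m → m ≤ length falses
    m≤falses ≤m = ℕ.+-cancelˡ-≤ m m _ (begin
      m + m                             ≡⟨ cong (λ n → m + n) (ℕ.+-identityʳ m) ⟨
      2 * m                             ≤⟨ 2m≤ ⟩
      length xs                         ≡⟨ length-filter-¬ true? xs ⟨
      length trues + length falses      ≤⟨ ℕ.+-monoˡ-≤ _ ≤m ⟩
      m + length falses                 ∎)

  -- Each bit of the colour is settled by one `majority` vote at the cost of a factor 2. The colours
  -- will be supports, which are Boolean vectors of length `M`.
  monochromatic : ∀ {M} n (colour : A → Vec Bool M) xs → Unique xs → 2 ^ M * n ≤ length xs →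
                  ∃[ c ] ∃[ ys ] n ≤ length ys × Unique ys ×
                  (∀ {y} → y ∈ˡ ys → y ∈ˡ xs × colour y ≡ c)
  monochromatic {zero} n colour xs xs! n≤ =
    [] , xs , subst (_≤ length xs) (ℕ.+-identityʳ n) n≤ , xs! , λ y∈xs → y∈xs , empty _
    where
    empty : (c : Vec Bool 0) → c ≡ []
    empty [] = refl
  monochromatic {suc M} n colour xs xs! n≤ =
    let b , ys , ≤ys , ys! , ys⊆ = majority (2 ^ M * n) (Vec.head ∘ colour) xs xs!
                                     (subst (_≤ length xs) (ℕ.*-assoc 2 (2 ^ M) n) n≤)
        c , zs , ≤zs , zs! , zs⊆ = monochromatic n (Vec.tail ∘ colour) ys ys! ≤ys
    in b ∷ c , zs , ≤zs , zs! , λ {z} z∈zs →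
      let z∈ys , tail≡c = zs⊆ z∈zs
          z∈xs , head≡b = ys⊆ z∈ys
      in z∈xs , trans (uncons (colour z)) (cong₂ _∷_ head≡b tail≡c)
    where
    uncons : (c : Vec Bool (suc M)) → c ≡ Vec.head c ∷ Vec.tail c
    uncons (_ ∷ _) = refl

monochromatic-Fin : ∀ {M} n {v} (colour : Fin v → Vec Bool M) → 2 ^ M * n ≤ v →
                    ∃[ c ] Σ[ X ∈ (Fin n → Fin v) ] Injective _≡_ _≡_ X × (∀ i → colour (X i) ≡ c)
monochromatic-Fin {M} n {v} colour n≤ =
  let c , ys , n≤ys , ys! , ys⊆ = monochromatic n colour (allFin v) (allFin⁺ v)
                                    (subst (2 ^ M * n ≤_) (sym (length-tabulate {n = v} (λ i → i))) n≤)
  in c , (λ i → lookup ys (inject≤ i n≤ys)) ,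
     (λ eq → Fin.inject≤-injective n≤ys n≤ys _ _ (lookup-injective ys! eq)) ,
     λ i → proj₂ (ys⊆ (∈-lookup (inject≤ i n≤ys)))

-- Functions between finite sets as numbers

funToFin-cong : ∀ {m n} {f g : Fin m → Fin n} → f ≗ g → funToFin f ≡ funToFin g
funToFin-cong {zero}  f≗g = refl
funToFin-cong {suc m} f≗g = cong₂ combine (f≗g zero) (funToFin-cong (f≗g ∘ suc))

finToFun-injective : ∀ {m n} {i j : Fin (n ^ m)} → finToFun {n} {m} i ≗ finToFun j → i ≡ j
finToFun-injective {m} {n} {i} {j} f≗g = begin
  i                              ≡⟨ Fin.funToFin-finToFin {m} {n} i ⟨
  funToFin (finToFun {n} {m} i)  ≡⟨ funToFin-cong f≗g ⟩
  funToFin (finToFun {n} {m} j)  ≡⟨ Fin.funToFin-finToFin {m} {n} j ⟩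
  j                              ∎
  where open ≡-Reasoning

-- Sets as images of tuples, and their sketches

∣p∪⁅x⁆∣≡1+∣p∣ : ∀ {n} (p : Subset n) {x} → x ∉ p → ∣ p ∪ˢ ⁅ x ⁆ ∣ ≡ suc ∣ p ∣
∣p∪⁅x⁆∣≡1+∣p∣ (inside  ∷ p) {zero}  x∉p = contradiction here x∉p
∣p∪⁅x⁆∣≡1+∣p∣ (outside ∷ p) {zero}  x∉p = cong (suc ∘ ∣_∣) (∪-identityʳ p)
∣p∪⁅x⁆∣≡1+∣p∣ (inside  ∷ p) {suc x} x∉p = cong suc (∣p∪⁅x⁆∣≡1+∣p∣ p (x∉p ∘ there))
∣p∪⁅x⁆∣≡1+∣p∣ (outside ∷ p) {suc x} x∉p = ∣p∪⁅x⁆∣≡1+∣p∣ p (x∉p ∘ there)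

module _ {v : ℕ} where

  -- `suc` skips the residue 0, so `Fin v` enumerates the nonzero residues for `V = suc v`.
  element : Fin v → 𝒰* (suc v)
  element i = suc i , [ (λ ()) ]

  -- Built by single insertions, `t zero` last, so that `canonical` describes every step when the
  -- tuple is injective.
  image : ∀ {d} → (Fin d → Fin v) → Subset* (suc v)
  image {zero}  t = ∅*
  image {suc d} t = image (t ∘ suc) ∪⁅ element (t zero) ⁆

  image-cong : ∀ {d} {t u : Fin d → Fin v} → t ≗ u → image t ≡ image u
  image-cong {zero}  t≗u = refl
  image-cong {suc d} t≗u = cong₂ (λ A i → A ∪⁅ element i ⁆) (image-cong (t≗u ∘ suc)) (t≗u zero)

  ∈-image⁺ : ∀ {d} (t : Fin d → Fin v) i → suc (t i) ∈ value (image t)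
  ∈-image⁺ t zero    = x∈p∪q⁺ (inj₂ (x∈⁅x⁆ _))
  ∈-image⁺ t (suc i) = x∈p∪q⁺ (inj₁ (∈-image⁺ (t ∘ suc) i))

  ∈-image⁻ : ∀ {d} (t : Fin d → Fin v) {y} → suc y ∈ value (image t) → ∃[ i ] y ≡ t i
  ∈-image⁻ {zero}  t y∈ = contradiction y∈ ∉⊥
  ∈-image⁻ {suc d} t y∈ with x∈p∪q⁻ (value (image (t ∘ suc))) ⁅ suc (t zero) ⁆ y∈
  ... | inj₁ y∈′ = let i , y≡ = ∈-image⁻ (t ∘ suc) y∈′ in suc i , y≡
  ... | inj₂ y∈′ = zero , Fin.suc-injective (x∈⁅y⁆⇒x≡y _ y∈′)

  head∉image-tail : ∀ {d} (t : Fin (suc d) → Fin v) → Injective _≡_ _≡_ t →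
                    element (t zero) ∉* image (t ∘ suc)
  head∉image-tail t t-inj t₀∈ with ∈-image⁻ (t ∘ suc) t₀∈
  ... | i , t₀≡ = Fin.0≢1+n (t-inj t₀≡)

  ∣image∣ : ∀ {d} (t : Fin d → Fin v) → Injective _≡_ _≡_ t → ∣ image t ∣* ≡ d
  ∣image∣ {zero}  t t-inj = ∣⊥∣≡0 (suc v)
  ∣image∣ {suc d} t t-inj = trans
    (∣p∪⁅x⁆∣≡1+∣p∣ (value (image (t ∘ suc))) (head∉image-tail t t-inj))
    (cong suc (∣image∣ (t ∘ suc) (Fin.suc-injective ∘ t-inj)))

  module _ {k M} {size : Vec ℕ M} (sketch : Sketch k (suc v) size) where
    open Sketch sketch

    -- Every insertion writes only in the common support `S`, so the cells outside keep their values
    -- from the empty sketch. Injectivity makes each inserted element new, as `canonical` requires.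
    cell-Enc-image : ∀ {S d} (t : Fin d → Fin v) → Injective _≡_ _≡_ t →
                     (∀ i → support (element (t i)) ≡ S) →
                     ∀ j → j ∉ S → cell (Enc (image t)) j ≡ cell (Enc ∅*) j
    cell-Enc-image {d = zero}  t t-inj support≡S j j∉S = refl
    cell-Enc-image {d = suc d} t t-inj support≡S j j∉S = begin
      cell (Enc (image t)) j                ≡⟨ cong (λ s → cell s j) (canonical A x (head∉image-tail t t-inj)) ⟩
      cell (Upd x (Enc A)) j                ≡⟨ fixed-support x (Enc A) j (subst (j ∉_) (sym (support≡S zero)) j∉S) ⟩
      cell (Enc A) j                        ≡⟨ cell-Enc-image (t ∘ suc) (Fin.suc-injective ∘ t-inj) (support≡S ∘ suc) j j∉S ⟩
      cell (Enc ∅*) j                       ∎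
      where
      open ≡-Reasoning
      A = image (t ∘ suc)
      x = element (t zero)

-- Counting states that agree outside a set of cells

capacity : ∀ {M} → Subset M → Vec ℕ M → ℕ
capacity []            []         = 1
capacity (inside  ∷ S) (n ∷ size) = n * capacity S size
capacity (outside ∷ S) (n ∷ size) = capacity S size

-- The cells in `S` read as a mixed-radix number, so that pigeonhole on `Fin` applies to states.
code : ∀ {M} (S : Subset M) {size : Vec ℕ M} → State size → Fin (capacity S size)
code []            []       = zero
code (inside  ∷ S) (c ∷ cs) = combine c (code S cs)
code (outside ∷ S) (c ∷ cs) = code S cs

code-injective : ∀ {M} (S : Subset M) {size : Vec ℕ M} (s t : State size) →
                 (∀ i → i ∉ S → cell s i ≡ cell t i) → code S s ≡ code S t → s ≡ t
code-injective []            []       []       _     _  = refl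
code-injective (inside  ∷ S) (b ∷ bs) (c ∷ cs) agree eq =
  let b≡c , eq′ = Fin.combine-injective b (code S bs) c (code S cs) eq
  in cong₂ _∷_ b≡c (code-injective S bs cs (λ i i∉S → agree (suc i) (λ where (there i∈S) → i∉S i∈S)) eq′)
code-injective (outside ∷ S) (b ∷ bs) (c ∷ cs) agree eq =
  cong₂ _∷_ (agree zero λ ())
    (code-injective S bs cs (λ i i∉S → agree (suc i) (λ where (there i∈S) → i∉S i∈S)) eq)

^-distribʳ-* : ∀ o m n → (m * n) ^ o ≡ m ^ o * n ^ o
^-distribʳ-* zero    m n = refl
^-distribʳ-* (suc o) m n = trans (cong (m * n *_) (^-distribʳ-* o m n)) (interchange ℕ.*-commutativeSemigroup m n (m ^ o) (n ^ o))

-- Cell sizes are bounded only through their `b`-th powers, since `V ^ (a / b)` is encoded without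
-- roots; the bound on their product keeps this form.
capacity-bound : ∀ {M} b B (S : Subset M) (size : Vec ℕ M) →
                 (∀ i → Vec.lookup size i ^ b ≤ B) → capacity S size ^ b ≤ B ^ ∣ S ∣
capacity-bound b B []            []         _      = ℕ.≤-reflexive (ℕ.^-zeroˡ b)
capacity-bound b B (inside  ∷ S) (n ∷ size) size≤B = begin
  (n * capacity S size) ^ b      ≡⟨ ^-distribʳ-* b n (capacity S size) ⟩
  n ^ b * capacity S size ^ b    ≤⟨ ℕ.*-mono-≤ (size≤B zero) (capacity-bound b B S size (size≤B ∘ suc)) ⟩
  B * B ^ ∣ S ∣                  ∎
  where open ℕ.≤-Reasoning
capacity-bound b B (outside ∷ S) (n ∷ size) size≤B = capacity-bound b B S size (size≤B ∘ suc)

module _ {v k M} {size : Vec ℕ M} (sketch : Sketch k (suc v) size) where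
  open Sketch sketch

  -- The d * m elements with support S split into d blocks of size m.  The
  -- transversals of the blocks are d-sets whose states agree outside S.
  decodable⇒capacity : ∀ d m → 1 ≤ d * m → 2 ^ M * (d * m) ≤ v →
    (∀ (t : Fin d → Fin v) → ∣ image t ∣* ≡ d → decode (Enc (image t)) ≡ image t) →
    ∃[ S ] ∣ S ∣ ≤ k × m ^ d ≤ capacity S size
  decodable⇒capacity d m 1≤dm enough decodes
    with S , X , X-inj , support≡S ← monochromatic-Fin (d * m) (support ∘ element) enough =
    S ,
    -- As `1 ≤ d * m`, the class has a first element, and `S` is its support.
    subst (λ S → ∣ S ∣ ≤ k) (support≡S (Fin.fromℕ< 1≤dm)) (support-size _) ,
    -- If the `m ^ d` choice functions outnumbered the codes, two distinct ones would share a code,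
    -- and decoding would then identify them.
    ℕ.≮⇒≥ λ capacity<m^d →
      let i , j , i<j , codes≡ = Fin.pigeonhole capacity<m^d
                                   (code S ∘ Enc ∘ image ∘ transversal ∘ finToFun)
      in Fin.<⇒≢ i<j (finToFun-injective {d} {m} (transversal-injective (states≡ _ _ codes≡)))
    where
    open ≡-Reasoning
    transversal : (Fin d → Fin m) → (Fin d → Fin v)
    transversal f i = X (combine i (f i))

    -- An element of the class determines its block and its position there, since `X` and `combine`
    -- are injective.
    block-injective : ∀ f g {i j} → transversal f i ≡ transversal g j → i ≡ j × f i ≡ g j
    block-injective f g eq = Fin.combine-injective _ _ _ _ (X-inj eq)

    Injective-transversal : ∀ f → Injective _≡_ _≡_ (transversal f)
    Injective-transversal f = proj₁ ∘ block-injective f f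

    -- The code determines the cells in `S`, the empty sketch those outside. Equal states decode to
    -- equal sets.
    states≡ : ∀ f g → code S (Enc (image (transversal f))) ≡ code S (Enc (image (transversal g))) →
              image (transversal f) ≡ image (transversal g)
    states≡ f g codes≡ = begin
      image (transversal f)                  ≡⟨ decoded f ⟨
      decode (Enc (image (transversal f)))   ≡⟨ cong decode (code-injective S _ _ agree codes≡) ⟩
      decode (Enc (image (transversal g)))   ≡⟨ decoded g ⟩
      image (transversal g)                  ∎
      where
      decoded : ∀ f → decode (Enc (image (transversal f))) ≡ image (transversal f)
      decoded f = decodes _ (∣image∣ _ (Injective-transversal f))

      fixed : ∀ f j → j ∉ S → cell (Enc (image (transversal f))) j ≡ cell (Enc ∅*) j
      fixed f = cell-Enc-image sketch (transversal f) (Injective-transversal f) λ _ → support≡S _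

      agree : ∀ j → j ∉ S → cell (Enc (image (transversal f))) j ≡ cell (Enc (image (transversal g))) j
      agree j j∉S = trans (fixed f j j∉S) (sym (fixed g j j∉S))

    -- The element chosen by `f` in block `i` occurs in the image for `g`. Blocks are disjoint, so
    -- it is the choice of `g` in that same block.
    transversal-injective : ∀ {f g} → image (transversal f) ≡ image (transversal g) → f ≗ g
    transversal-injective {f} {g} eq i
      with j , eq′ ← ∈-image⁻ (transversal g) (subst (λ A → _ ∈ value A) eq (∈-image⁺ (transversal f) i))
      with refl , fᵢ≡gᵢ ← block-injective f g eq′ = fᵢ≡gᵢ

-- Combining the bounds

^-cancelʳ-≤ : ∀ m n o .{{_ : NonZero o}} → m ^ o ≤ n ^ o → m ≤ n
^-cancelʳ-≤ m n o m^o≤n^o = ℕ.≮⇒≥ λ n<m → ℕ.<⇒≱ (ℕ.^-monoˡ-< o n<m) m^o≤n^o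

-- Used with c = 2 ^ M * d, for blocks of size m = v / c in the universe V = suc v.
threshold : ℕ → ℕ → ℕ
threshold c d = (2 * c) ^ (2 * d)

-- The last hypothesis says that `P` is at most `V` to the power `ℓ * k + ½`. Squaring clears the
-- half, `V ≤ 2 * c * m` turns a power of `V` into one of `m`, and the power `V ^ a` cancels.
universe-bound : ∀ ℓ k d c V m P .{{_ : NonZero k}} .{{_ : NonZero V}} → ℓ * k + 1 ≤ d →
                 V ≤ 2 * c * m → m ^ d ≤ P → P ^ (2 * k) ≤ (V ^ (ℓ * (2 * k) + 1)) ^ k →
                 V ≤ threshold c d
universe-bound ℓ k d c V m P ℓk<d V≤ m^d≤P P≤ =
  ℕ.*-cancelʳ-≤ V (threshold c d) (V ^ a) {{ℕ.m^n≢0 V a}} (begin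
    V ^ suc a                        ≤⟨ ℕ.^-monoʳ-≤ V 1+a≤2d ⟩
    V ^ (2 * d)                      ≤⟨ ℕ.^-monoˡ-≤ (2 * d) V≤ ⟩
    (2 * c * m) ^ (2 * d)            ≡⟨ ^-distribʳ-* (2 * d) (2 * c) m ⟩
    threshold c d * m ^ (2 * d)      ≡⟨ cong (λ e → threshold c d * m ^ e) (ℕ.*-comm 2 d) ⟩
    threshold c d * m ^ (d * 2)      ≡⟨ cong (threshold c d *_) (ℕ.^-*-assoc m d 2) ⟨
    threshold c d * (m ^ d) ^ 2      ≤⟨ ℕ.*-monoʳ-≤ (threshold c d) (ℕ.^-monoˡ-≤ 2 m^d≤P) ⟩
    threshold c d * P ^ 2            ≤⟨ ℕ.*-monoʳ-≤ (threshold c d) P²≤V^a ⟩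
    threshold c d * V ^ a            ∎)
  where
  open ℕ.≤-Reasoning
  a = ℓ * (2 * k) + 1

  P²≤V^a : P ^ 2 ≤ V ^ a
  P²≤V^a = ^-cancelʳ-≤ (P ^ 2) (V ^ a) k (subst (_≤ (V ^ a) ^ k) (sym (ℕ.^-*-assoc P 2 k)) P≤)

  -- The gap of at least ½ between `ℓ * k + ½` and `d` doubles to one whole factor `V`.
  1+a≤2d : suc a ≤ 2 * d
  1+a≤2d = begin
    suc (ℓ * (2 * k) + 1)      ≡⟨ solve 2 (λ ℓ k → con 1 :+ (ℓ :* (con 2 :* k) :+ con 1) := con 2 :* (ℓ :* k :+ con 1)) refl ℓ k ⟩
    2 * (ℓ * k + 1)            ≤⟨ ℕ.*-monoʳ-≤ 2 ℓk<d ⟩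
    2 * d                      ∎
    where open +-*-Solver

-- Rounding `v / c` down costs at most a factor 2: `c ≤ v` makes the quotient positive, so the
-- remainder plus 1 is at most `c ≤ m * c`.
1+v≤2cm : ∀ v c .{{_ : NonZero c}} → c ≤ v → suc v ≤ 2 * c * (v / c)
1+v≤2cm v c c≤v = begin
    suc v                         ≡⟨ cong suc (m≡m%n+[m/n]*n v c) ⟩
    suc (v % c) + m * c           ≤⟨ ℕ.+-monoˡ-≤ (m * c) (m%n<n v c) ⟩
    c + m * c                     ≡⟨ cong (_+ m * c) (ℕ.*-identityˡ c) ⟨
    1 * c + m * c                 ≤⟨ ℕ.+-monoˡ-≤ (m * c) (ℕ.*-monoˡ-≤ c (m≥n⇒m/n>0 c≤v)) ⟩
    m * c + m * c                 ≡⟨ solve 2 (λ m c → m :* c :+ m :* c := con 2 :* c :* m) refl m c ⟩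
    2 * c * m                     ∎
  where
  open ℕ.≤-Reasoning
  open +-*-Solver
  m = v / c

-- From zero error to a single sketch, and the conclusion

module _ {k ℓ} (𝒜 : SketchFamily k ℓ) (d v : ℕ) (p : Prime (suc v)) where
  open SketchFamily 𝒜
  open ProbabilitySpace (randomness d (suc v) p)

  -- The size premise makes the event certain for the image of a non-injective
  -- tuple, so all v ^ d tuples can serve as the finite index set.
  Decodes : Subset* (suc v) → Pred Ω 0ℓ
  Decodes A ω = ∣ A ∣* ≡ d → decode (Enc A) ≡ A
    where open Sketch (sketch d (suc v) p ω)

  zeroError⇒consistent : ZeroError 𝒜 d (suc v) p →
                         ¬ (∀ ω → ¬ (∀ (t : Fin d → Fin v) → Decodes (image t) ω))
  zeroError⇒consistent zero-error none = Pr≡1⇒consistent (randomness d (suc v) p)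
      (λ i ω → (_ ℕ.≟ _) →-dec Refinement._≟_ (Vec.≡-dec Bool._≟_) _ _)
      (sure ∘ image ∘ finToFun)
      -- A tuple `t` agrees only pointwise with the one decoded from `funToFin t`; `image-cong`
      -- makes this enough.
      (λ ω decodes → none ω λ t →
        subst (λ A → Decodes A ω) (image-cong (Fin.finToFun-funToFin t)) (decodes (funToFin t)))
    where
    open ≤ᴿ-Reasoning
    Pr≡1-resp : ∀ {E F} → E ≐ F → Pr[ E ]≡1 → Pr[ F ]≡1
    Pr≡1-resp E≐F (e , ℙe≈1) = let f = ≐-measurable E≐F e in f , (begin-equality
      ℙ f      ≈⟨ ℙ-resp E≐F e f ⟨
      ℙ e      ≈⟨ ℙe≈1 ⟩
      1ℝ       ∎)

    sure : ∀ A → Pr[ Decodes A ]≡1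
    sure A = case ∣ A ∣* ℕ.≟ d of λ where
      (no  ∣A∣≢d) → Pr≡1-resp ((λ _ ∣A∣≡d → contradiction ∣A∣≡d ∣A∣≢d) , _) (U-measurable , ℙ-U)
      (yes ∣A∣≡d) → Pr≡1-resp ((λ eq _ → eq) , (λ eq → eq ∣A∣≡d)) (zero-error A ∣A∣≡d)

theorem2 : (ℓ k d : ℕ) → 1 ≤ ℓ → 1 ≤ k → ℓ * k + 1 ≤ d →
    (𝒜 : SketchFamily k ℓ) →
    ∃[ V₀ ] (∀ V → (p : Prime V) → V₀ ≤ V → ¬ ZeroError 𝒜 d V p)
theorem2 ℓ k@(suc _) zero _ _ ℓk<d 𝒜 = contradiction (ℕ.≤-trans (ℕ.m≤n+m 1 (ℓ * k)) ℓk<d) λ ()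
theorem2 ℓ k@(suc _) d@(suc _) _ _ ℓk<d 𝒜 = V₀ , refute
  where
  open SketchFamily 𝒜
  -- With `r` at most `1 / b`, the at most `k` cells of a support add at most ½ to the exponent
  -- `ℓ * k`.
  b = 2 * k
  -- `M d` does not depend on `V`, so neither do `c` and the threshold.
  c = 2 ^ M d * d

  instance
    c≢0 : NonZero c
    c≢0 = ℕ.m*n≢0 (2 ^ M d) d {{ℕ.m^n≢0 2 (M d)}}

  N : ℕ
  N = proj₁ (r→0 d (+ 1 ℚ./ b) (ℚ.positive⁻¹ (+ 1 ℚ./ b) {{ℚ.normalize-pos 1 b}}))

  V₀ : ℕ
  -- From `N` on, `r d V` is at most `1 / b` at primes; `suc` puts `V` strictly above the threshold,
  -- against `universe-bound`.
  V₀ = N ⊔ suc (threshold c d)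

  refute : ∀ V → (p : Prime V) → V₀ ≤ V → ¬ ZeroError 𝒜 d V p
  refute zero    _ V₀≤V _          = contradiction (ℕ.m⊔n≤o⇒n≤o N _ V₀≤V) λ ()
  refute V@(suc v) p V₀≤V zero-error = zeroError⇒consistent 𝒜 d v p zero-error λ ω decodes →
    let S , ∣S∣≤k , m^d≤P = decodable⇒capacity (sketch d V p ω) d m 1≤dm enough decodes
    in ℕ.<⇒≱ K<V (universe-bound ℓ k d c V m (capacity S (size d V)) ℓk<d (1+v≤2cm v c c≤v) m^d≤P
         (ℕ.≤-trans (capacity-bound b (V ^ (ℓ * b + 1)) S (size d V) cell-bound)
                    (ℕ.^-monoʳ-≤ (V ^ (ℓ * b + 1)) {{ℕ.m^n≢0 V (ℓ * b + 1)}} ∣S∣≤k)))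
    where
    open ℕ.≤-Reasoning
    m = v / c

    K<V : threshold c d ℕ.< V
    K<V = ℕ.m⊔n≤o⇒n≤o N _ V₀≤V

    -- Makes the block size `m` positive. The threshold dominates `c` because its exponent `2 * d`
    -- is at least 1.
    c≤v : c ≤ v
    c≤v = begin
      c                 ≤⟨ ℕ.m≤n*m c 2 ⟩
      2 * c             ≡⟨ ℕ.^-identityʳ (2 * c) ⟨
      (2 * c) ^ 1       ≤⟨ ℕ.^-monoʳ-≤ (2 * c) {{ℕ.m*n≢0 2 c}} {1} {2 * d} (s≤s z≤n) ⟩
      threshold c d     ≤⟨ s≤s⁻¹ K<V ⟩
      v                 ∎

    1≤dm : 1 ≤ d * m
    1≤dm = ℕ.*-mono-≤ {1} {d} (s≤s z≤n) (m≥n⇒m/n>0 c≤v)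

    enough : 2 ^ M d * (d * m) ≤ v
    enough = begin
      2 ^ M d * (d * m)      ≡⟨ ℕ.*-assoc (2 ^ M d) d m ⟨
      c * m                  ≡⟨ ℕ.*-comm c m ⟩
      m * c                  ≤⟨ m/n*n≤m v c ⟩
      v                      ∎

    cell-bound : ∀ i → Vec.lookup (size d V) i ^ b ≤ V ^ (ℓ * b + 1)
    cell-bound i = size-bound d V p i (+ (ℓ * b + 1)) b (exponent-bound ℓ b (r d V)
      (proj₁ (proj₂ (r→0 d (+ 1 ℚ./ b) _) V p (ℕ.m⊔n≤o⇒m≤o N _ V₀≤V))))
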